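{- Let $(x_k)_{k\ge0}$ be indeterminates, define $a_n=x_n$ if $n=2^k-1$ for some integer $k\ge0$ and $a_n=0$ otherwise, let $D(n)=\det\left(a_{i+j+1}\right)_{i,j=0}^{n-1}$ with $D(0)=1$, and let $T_n=\frac{D(n)D(n+2)}{D(n+1)^2}$ (in the field of rational functions). Then for all $n\ge0$, $$T_{2n+1}=-T_{2n},\qquad T_{4n}=(-1)^n\frac{x_3}{x_1},$$ and for all $k\ge2$ and $n\ge0$, $$T_{2^{k+1}n+2^k-1}=(-1)^n\frac{x_1x_{2^{k+1}-1}}{x_{2^k-1}^2}.$$ -}

module Defs where

open import Algebra.Bundles using (CommutativeRing)
import Algebra.Properties.Monoid.Sum as Sum
import Algebra.Properties.Semiring.Exp as Exp
open import Data.Bool.Base using (if_then_else_)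
open import Data.Fin.Base using (Fin; zero; suc; toℕ; punchIn)
open import Data.Integer.Base as ℤ using (ℤ; 0ℤ; 1ℤ)
import Data.Integer.Properties as ℤₚ
open import Data.Nat.Base as ℕ using (ℕ; zero; suc; s≤s; z≤n; _∸_)
import Data.Nat.Properties as ℕₚ
open import Data.Product.Base using (∃-syntax; _×_; _,_)
open import Level using (0ℓ)
open import Relation.Binary.PropositionalEquality
  using (_≡_; refl; sym; trans; cong; cong₂; subst)
open import Relation.Nullary.Decidable using (Dec; does; map′)
open import Relation.Nullary.Negation using (¬_)

------------------------------------------------------------------------
-- Determinants over a commutative ring, by Laplace expansion along the
-- first row; the empty determinant is 1.

module Determinant {c ℓ} (R : CommutativeRing c ℓ) where
  open CommutativeRing R hiding (zero)
  open Sum +-monoid using (sum)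
  open Exp semiring using (_^_)

  det : ∀ {n} → (Fin n → Fin n → Carrier) → Carrier
  det {zero}  A = 1#
  det {suc n} A = sum λ j →
    (- 1#) ^ toℕ j * (A zero j * det (λ r c → A (suc r) (punchIn j c)))

------------------------------------------------------------------------
-- The polynomial ring ℤ[x₀, x₁, x₂, …], as the free commutative ring on
-- countably many generators: ring terms modulo the congruence generated
-- by the commutative ring axioms, and nothing else.

infix  8 ⊝_
infixl 7 _⊗_
infixl 6 _⊕_
infix  4 _≈_

data Poly : Set where
  x       : ℕ → Poly
  𝟘 𝟙     : Poly
  _⊕_ _⊗_ : Poly → Poly → Poly
  ⊝_      : Poly → Poly

data _≈_ : Poly → Poly → Set where
  ≈-refl    : ∀ {p} → p ≈ p
  ≈-sym     : ∀ {p q} → p ≈ q → q ≈ p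
  ≈-trans   : ∀ {p q r} → p ≈ q → q ≈ r → p ≈ r
  ⊕-cong    : ∀ {p p′ q q′} → p ≈ p′ → q ≈ q′ → p ⊕ q ≈ p′ ⊕ q′
  ⊗-cong    : ∀ {p p′ q q′} → p ≈ p′ → q ≈ q′ → p ⊗ q ≈ p′ ⊗ q′
  ⊝-cong    : ∀ {p p′} → p ≈ p′ → ⊝ p ≈ ⊝ p′
  ⊕-assoc   : ∀ p q r → (p ⊕ q) ⊕ r ≈ p ⊕ (q ⊕ r)
  ⊕-comm    : ∀ p q → p ⊕ q ≈ q ⊕ p
  ⊕-idˡ     : ∀ p → 𝟘 ⊕ p ≈ p
  ⊕-invˡ    : ∀ p → (⊝ p) ⊕ p ≈ 𝟘
  ⊗-assoc   : ∀ p q r → (p ⊗ q) ⊗ r ≈ p ⊗ (q ⊗ r)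
  ⊗-comm    : ∀ p q → p ⊗ q ≈ q ⊗ p
  ⊗-idˡ     : ∀ p → 𝟙 ⊗ p ≈ p
  ⊗-distˡ-⊕ : ∀ p q r → p ⊗ (q ⊕ r) ≈ (p ⊗ q) ⊕ (p ⊗ r)

ℤ[x] : CommutativeRing 0ℓ 0ℓ
ℤ[x] = record
  { Carrier = Poly
  ; _≈_     = _≈_
  ; _+_     = _⊕_
  ; _*_     = _⊗_
  ; -_      = ⊝_
  ; 0#      = 𝟘
  ; 1#      = 𝟙
  ; isCommutativeRing = record
    { isRing = record
      { +-isAbelianGroup = record
        { isGroup = record
          { isMonoid = record
            { isSemigroup = record
              { isMagma = record
                { isEquivalence = record
                  { refl = ≈-refl ; sym = ≈-sym ; trans = ≈-trans }
                ; ∙-cong = ⊕-cong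
                }
              ; assoc = ⊕-assoc
              }
            ; identity = ⊕-idˡ , λ p → ≈-trans (⊕-comm p 𝟘) (⊕-idˡ p)
            }
          ; inverse =
              ⊕-invˡ , λ p → ≈-trans (⊕-comm p (⊝ p)) (⊕-invˡ p)
          ; ⁻¹-cong = ⊝-cong
          }
        ; comm = ⊕-comm
        }
      ; *-cong     = ⊗-cong
      ; *-assoc    = ⊗-assoc
      ; *-identity = ⊗-idˡ , λ p → ≈-trans (⊗-comm p 𝟙) (⊗-idˡ p)
      ; distrib    = ⊗-distˡ-⊕ , λ p q r →
          ≈-trans (⊗-comm (q ⊕ r) p)
            (≈-trans (⊗-distˡ-⊕ p q r)
              (⊕-cong (⊗-comm p q) (⊗-comm p r)))
      }
    ; *-comm = ⊗-comm
    }
  }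

open Exp (CommutativeRing.semiring ℤ[x]) public using (_^_)
open Determinant ℤ[x] public using (det)

infix 4 _≉_
_≉_ : Poly → Poly → Set
p ≉ q = ¬ (p ≈ q)

-- Evaluation at an integer point, used to see that a polynomial is
-- nonzero.

eval : (ℕ → ℤ) → Poly → ℤ
eval v (x i)   = v i
eval v 𝟘       = 0ℤ
eval v 𝟙       = 1ℤ
eval v (p ⊕ q) = eval v p ℤ.+ eval v q
eval v (p ⊗ q) = eval v p ℤ.* eval v q
eval v (⊝ p)   = ℤ.- eval v p

eval-cong : ∀ v {p q} → p ≈ q → eval v p ≡ eval v q
eval-cong v ≈-refl            = refl
eval-cong v (≈-sym e)         = sym (eval-cong v e)
eval-cong v (≈-trans e f)     = trans (eval-cong v e) (eval-cong v f)
eval-cong v (⊕-cong e f)      = cong₂ ℤ._+_ (eval-cong v e) (eval-cong v f)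
eval-cong v (⊗-cong e f)      = cong₂ ℤ._*_ (eval-cong v e) (eval-cong v f)
eval-cong v (⊝-cong e)        = cong ℤ.-_ (eval-cong v e)
eval-cong v (⊕-assoc p q r)   = ℤₚ.+-assoc (eval v p) _ _
eval-cong v (⊕-comm p q)      = ℤₚ.+-comm (eval v p) _
eval-cong v (⊕-idˡ p)         = ℤₚ.+-identityˡ _
eval-cong v (⊕-invˡ p)        = ℤₚ.+-inverseˡ (eval v p)
eval-cong v (⊗-assoc p q r)   = ℤₚ.*-assoc (eval v p) _ _
eval-cong v (⊗-comm p q)      = ℤₚ.*-comm (eval v p) _
eval-cong v (⊗-idˡ p)         = ℤₚ.*-identityˡ _
eval-cong v (⊗-distˡ-⊕ p q r) = ℤₚ.*-distribˡ-+ (eval v p) _ _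

x≉0 : ∀ i → x i ≉ 𝟘
x≉0 i e with () ← eval-cong (λ _ → 1ℤ) e

x²≉0 : ∀ i → x i ^ 2 ≉ 𝟘
x²≉0 i e with () ← eval-cong (λ _ → 1ℤ) e

------------------------------------------------------------------------
-- Rational functions: the fractions of the integral domain
-- ℤ[x₀, x₁, x₂, …], so the elements of ℚ(x₀, x₁, x₂, …).

infix 5 _/_⟨_⟩
record RatFun : Set where
  constructor _/_⟨_⟩
  field
    num   : Poly
    den   : Poly
    den≉0 : den ≉ 𝟘

infix 4 _≃_
_≃_ : RatFun → RatFun → Set
(p / q ⟨ _ ⟩) ≃ (r / s ⟨ _ ⟩) = p ⊗ s ≈ r ⊗ q

infix 8 -_
-_ : RatFun → RatFun
- (p / q ⟨ nz ⟩) = (⊝ p) / q ⟨ nz ⟩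

------------------------------------------------------------------------
-- The Hankel determinants

n<2^n : ∀ n → n ℕ.< 2 ℕ.^ n
n<2^n zero    = s≤s z≤n
n<2^n (suc n) = ℕₚ.+-mono-≤ (ℕₚ.m^n>0 2 n) (subst (suc n ℕ.≤_)
  (sym (ℕₚ.+-identityʳ (2 ℕ.^ n))) (n<2^n n))

mersenne? : ∀ n → Dec (∃[ k ] n ≡ 2 ℕ.^ k ∸ 1)
mersenne? n = map′
  (λ { (k , _ , eq) → k , eq })
  (λ { (k , eq) → k , s≤s (subst (k ℕ.≤_) (sym eq) (ℕₚ.<⇒≤pred (n<2^n k))) , eq })
  (ℕₚ.anyUpTo? (λ k → n ℕₚ.≟ 2 ℕ.^ k ∸ 1) (suc n))

a : ℕ → Poly
a n = if does (mersenne? n) then x n else 𝟘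

D : ℕ → Poly
D n = det {n} (λ i j → a (toℕ i ℕ.+ toℕ j ℕ.+ 1))

-- T is a rational function only once its denominators are known to be
-- nonzero, which is taken as an argument.

T : (∀ n → D (n ℕ.+ 1) ^ 2 ≉ 𝟘) → ℕ → RatFun
T D²≉0 n = (D n ⊗ D (n ℕ.+ 2)) / D (n ℕ.+ 1) ^ 2 ⟨ D²≉0 n ⟩

{-# OPTIONS --safe #-}
-- Let N = 2^k ≤ n < 2N, n = N + r. A row or column of the Hankel matrix with
-- (1-based) index i ≥ N has a single nonzero entry, x_{2N-1}, facing 2N - i.
-- Expanding along them, outermost first, gives
--   D(N + r) = (-1)^r x_{2N-1}^{2r+1} D(N - 1 - r).
-- The prefactors of three consecutive values form a geometric progression, so
-- they drop out of T, whence T_n = T_{2N-3-n} for N ≤ n ≤ 2N - 3; only n = 2N - 2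
-- and n = 2N - 1 are computed directly. All relations are kept cross-multiplied:
-- reflecting a relation then multiplies both sides by the same factor, and no
-- cancellation in ℤ[x] is ever needed.
module Submission where

open import Algebra.Bundles using (CommutativeRing)
open import Data.Bool.Base using (if_then_else_)
open import Data.Fin.Base using (Fin; zero; suc; toℕ; punchIn; fromℕ; fromℕ<)
import Data.Fin.Properties as Finₚ
open import Data.Integer.Base as ℤ using (ℤ; 0ℤ; 1ℤ)
import Data.Integer.Properties as ℤₚ
import Data.Integer.Tactic.RingSolver as ℤ-Solver
open import Data.Nat.Base as ℕ using (ℕ; zero; suc; _<_; z≤n; s≤s; s<s)
open import Data.Nat.Induction using (<-rec)
import Data.Nat.Properties as ℕₚ
open import Data.Nat.Tactic.RingSolver using (solve-∀)
open import Data.Product using (∃-syntax; _,_)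
open import Data.Sum.Base using (_⊎_; inj₁; inj₂)
open import Function.Base using (_∘_)
open import Relation.Binary.PropositionalEquality as ≡ using (_≡_; _≢_)
open import Relation.Nullary.Decidable using (dec-true; dec-false)
open import Relation.Nullary.Negation using (¬_; contradiction)
open import Defs using (module Determinant)

-- Laplace expansion at a row or column with a single nonzero entry.

module Laplace {c ℓ} (R : CommutativeRing c ℓ) where
  open CommutativeRing R hiding (zero)
  open Determinant R using (det)
  open import Algebra.Properties.Semiring.Exp semiring using (_^_; ^-homo-*)
  open import Algebra.Properties.CommutativeMonoid.Sum +-commutativeMonoid
    using (sum; sum-remove; sum-cong-≋; sum-replicate-zero)
  open import Algebra.Properties.Semiring.Sum semiring using (*-distribˡ-sum)
  open import Algebra.Properties.Ring ring using (-1*x≈-x; -‿involutive)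
  open import Algebra.Solver.Ring.NaturalCoefficients.Default commutativeSemiring
    using (solve; _:=_; _:*_; con)
  open import Relation.Binary.Reasoning.Setoid setoid

  Matrix : ℕ → Set c
  Matrix n = Fin n → Fin n → Carrier

  minor : ∀ {n} → Matrix (suc n) → Fin (suc n) → Fin (suc n) → Matrix n
  minor A i j r c = A (punchIn i r) (punchIn j c)

  -1*-1≈1 : - 1# * - 1# ≈ 1#
  -1*-1≈1 = trans (-1*x≈-x (- 1#)) (-‿involutive 1#)

  term : ∀ {n} → Matrix (suc n) → Fin (suc n) → Carrier
  term A j = (- 1#) ^ toℕ j * (A zero j * det (minor A zero j))

  sum-cong : ∀ {n} {f g : Fin n → Carrier} → (∀ i → f i ≈ g i) → sum f ≈ sum g
  sum-cong {n} = sum-cong-≋ {n}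

  sum-zero : ∀ {n} {f : Fin n → Carrier} → (∀ i → f i ≈ 0#) → sum f ≈ 0#
  sum-zero {n} f≈0 = trans (sum-cong f≈0) (sum-replicate-zero n)

  det-cong : ∀ {n} {A B : Matrix n} → (∀ i j → A i j ≈ B i j) → det A ≈ det B
  det-cong {zero}          A≈B = refl
  det-cong {suc n} {A} {B} A≈B = sum-cong {f = term A} {term B} λ j →
    *-congˡ (*-cong (A≈B zero j) (det-cong λ r c → A≈B (suc r) (punchIn j c)))

  term-zero-entry : ∀ {n} (A : Matrix (suc n)) j → A zero j ≈ 0# → term A j ≈ 0#
  term-zero-entry A j z = trans (*-congˡ (trans (*-congʳ z) (zeroˡ _))) (zeroʳ _)

  term-zero-minor : ∀ {n} (A : Matrix (suc n)) j → det (minor A zero j) ≈ 0# → term A j ≈ 0#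
  term-zero-minor A j z = trans (*-congˡ (trans (*-congˡ z) (zeroʳ _))) (zeroʳ _)

  -- The position of column `j` once column `punchIn j l` is deleted: a total form of `punchOut`,
  -- with the distinctness of the two columns built into the parametrisation by `l`.
  dodge : ∀ {n} → Fin (suc (suc n)) → Fin (suc n) → Fin (suc n)
  dodge         zero    l       = zero
  dodge         (suc j) zero    = j
  dodge {suc n} (suc j) (suc l) = suc (dodge j l)

  punchIn-dodge : ∀ {n} (j : Fin (suc (suc n))) l → punchIn (punchIn j l) (dodge j l) ≡ j
  punchIn-dodge         zero    l       = ≡.refl
  punchIn-dodge         (suc j) zero    = ≡.refl
  punchIn-dodge {suc n} (suc j) (suc l) = ≡.cong suc (punchIn-dodge j l)

  punchIn-punchIn-dodge : ∀ {n} (j : Fin (suc (suc n))) l c →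
    punchIn (punchIn j l) (punchIn (dodge j l) c) ≡ punchIn j (punchIn l c)
  punchIn-punchIn-dodge         zero    l       c       = ≡.refl
  punchIn-punchIn-dodge         (suc j) zero    c       = ≡.refl
  punchIn-punchIn-dodge {suc n} (suc j) (suc l) zero    = ≡.refl
  punchIn-punchIn-dodge {suc n} (suc j) (suc l) (suc c) =
    ≡.cong suc (punchIn-punchIn-dodge j l c)

  -- The same two columns are deleted in either order. The right-hand one loses one from its index
  -- exactly when it goes second, so the two index sums differ by one.
  dodge-sign : ∀ {n} (j : Fin (suc (suc n))) l →
    (- 1#) ^ toℕ (punchIn j l) * (- 1#) ^ toℕ (dodge j l)
      ≈ - 1# * ((- 1#) ^ toℕ j * (- 1#) ^ toℕ l)
  dodge-sign zero l =
    solve 2 (λ s p → (s :* p) :* con 1 := s :* (con 1 :* p)) refl (- 1#) ((- 1#) ^ toℕ l)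
  dodge-sign (suc j) zero = begin
    1# * (- 1#) ^ toℕ j                     ≈⟨ *-congʳ -1*-1≈1 ⟨
    (- 1# * - 1#) * (- 1#) ^ toℕ j          ≈⟨ *-assoc _ _ _ ⟩
    - 1# * (- 1# * (- 1#) ^ toℕ j)          ≈⟨ *-congˡ (*-identityʳ _) ⟨
    - 1# * ((- 1# * (- 1#) ^ toℕ j) * 1#)   ∎
  dodge-sign {suc n} (suc j) (suc l) = begin
    (s * p) * (s * q)       ≈⟨ solve 3 (λ s p q → (s :* p) :* (s :* q) := (s :* s) :* (p :* q)) refl s p q ⟩
    (s * s) * (p * q)       ≈⟨ *-congˡ (dodge-sign j l) ⟩
    (s * s) * (s * (u * v)) ≈⟨ solve 3 (λ s u v → (s :* s) :* (s :* (u :* v)) := s :* ((s :* u) :* (s :* v))) refl s u v ⟩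
    s * ((s * u) * (s * v)) ∎
    where
    s = - 1#
    p = s ^ toℕ (punchIn j l)
    q = s ^ toℕ (dodge j l)
    u = s ^ toℕ j
    v = s ^ toℕ l

  det-zero-row : ∀ {n} (A : Matrix n) i → (∀ c → A i c ≈ 0#) → det A ≈ 0#
  det-zero-row A zero z = sum-zero {f = term A} λ j → term-zero-entry A j (z j)
  det-zero-row {suc (suc n)} A (suc i) z = sum-zero {f = term A} λ j →
    term-zero-minor A j (det-zero-row (minor A zero j) i λ c → z (punchIn j c))

  -- In the first-row expansion, term `j` has a zero entry, and every other minor still contains the
  -- zero column, now at position `dodge j l`.
  det-zero-column : ∀ {n} (A : Matrix n) j → (∀ r → A r j ≈ 0#) → det A ≈ 0#
  term-zero-column : ∀ {n} (A : Matrix (suc n)) j l →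
    (∀ r → A (suc r) j ≈ 0#) → term A (punchIn j l) ≈ 0#

  det-zero-column {suc n} A j z = begin
    det A                                   ≈⟨ sum-remove {i = j} (term A) ⟩
    term A j + sum (λ l → term A (punchIn j l))
      ≈⟨ +-cong (term-zero-entry A j (z zero))
                (sum-zero {f = λ l → term A (punchIn j l)} λ l → term-zero-column A j l (z ∘ suc)) ⟩
    0# + 0#                                 ≈⟨ +-identityˡ 0# ⟩
    0#                                      ∎

  term-zero-column {suc n} A j l z = term-zero-minor A (punchIn j l)
    (det-zero-column (minor A zero (punchIn j l)) (dodge j l) λ r →
      trans (reflexive (≡.cong (A (suc r)) (punchIn-dodge j l))) (z r))

  Isolated : ∀ {n} → Matrix (suc n) → Fin (suc n) → Fin (suc n) → Set ℓ
  Isolated A i j = (∀ c → A i (punchIn j c) ≈ 0#) ⊎ (∀ r → A (punchIn i r) j ≈ 0#)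

  -- Induction on `i`. For `suc i`, term `j` of the first-row expansion vanishes; in each other
  -- minor the isolated entry persists, so the hypothesis extracts it, and the remaining sum is the
  -- first-row expansion of `minor A (suc i) j`. `dodge-sign` accounts for the signs.
  det-isolated : ∀ {n} (A : Matrix (suc n)) i j → Isolated A i j →
    det A ≈ (- 1#) ^ (toℕ i ℕ.+ toℕ j) * (A i j * det (minor A i j))
  det-isolated A zero j iso = begin
    det A                                       ≈⟨ sum-remove {i = j} (term A) ⟩
    term A j + sum (λ l → term A (punchIn j l)) ≈⟨ +-congˡ (sum-zero {f = λ l → term A (punchIn j l)} (vanish iso)) ⟩
    term A j + 0#                               ≈⟨ +-identityʳ (term A j) ⟩
    term A j                                    ∎
    where
    vanish : Isolated A zero j → ∀ l → term A (punchIn j l) ≈ 0#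
    vanish (inj₁ row) l = term-zero-entry A (punchIn j l) (row l)
    vanish (inj₂ col) l = term-zero-column A j l col
  det-isolated {suc n} A (suc i) j iso = begin
    det A                                       ≈⟨ sum-remove {i = j} (term A) ⟩
    term A j + sum (λ l → term A (punchIn j l)) ≈⟨ +-cong (vanish iso) (sum-cong step) ⟩
    0# + sum (λ l → e * f l)                    ≈⟨ +-identityˡ _ ⟩
    sum (λ l → e * f l)                         ≈⟨ *-distribˡ-sum e f ⟨
    e * sum f                                   ≈⟨ *-assoc _ _ _ ⟩
    s ^ suc (toℕ i ℕ.+ toℕ j) * (A (suc i) j * det (minor A (suc i) j)) ∎
    where
    s = - 1#
    e = s ^ suc (toℕ i ℕ.+ toℕ j) * A (suc i) j
    f : Fin (suc n) → Carrier
    f = term (minor A (suc i) j)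
    vanish : Isolated A (suc i) j → term A j ≈ 0#
    vanish (inj₁ row) = term-zero-minor A j (det-zero-row (minor A zero j) i row)
    vanish (inj₂ col) = term-zero-entry A j (col zero)
    step : ∀ l → term A (punchIn j l) ≈ e * f l
    step l = begin
      s ^ toℕ k * (a₀ * det (minor A zero k))
        ≈⟨ *-congˡ (*-congˡ (det-isolated (minor A zero k) i q (iso′ iso))) ⟩
      s ^ toℕ k * (a₀ * (s ^ (toℕ i ℕ.+ toℕ q) * (A (suc i) (punchIn k q) * det (minor (minor A zero k) i q))))
        ≈⟨ *-congˡ (*-congˡ (*-cong (^-homo-* s (toℕ i) (toℕ q)) (*-cong
             (reflexive (≡.cong (A (suc i)) (punchIn-dodge j l)))
             (det-cong λ r c → reflexive (≡.cong (A (suc (punchIn i r))) (punchIn-punchIn-dodge j l c)))))) ⟩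
      s ^ toℕ k * (a₀ * ((s ^ toℕ i * s ^ toℕ q) * (b * d)))
        ≈⟨ solve 6 (λ p a u v b d → p :* (a :* ((u :* v) :* (b :* d))) := (p :* v) :* (u :* (a :* (b :* d))))
             refl (s ^ toℕ k) a₀ (s ^ toℕ i) (s ^ toℕ q) b d ⟩
      (s ^ toℕ k * s ^ toℕ q) * (s ^ toℕ i * (a₀ * (b * d)))
        ≈⟨ *-congʳ (dodge-sign j l) ⟩
      (s * (s ^ toℕ j * s ^ toℕ l)) * (s ^ toℕ i * (a₀ * (b * d)))
        ≈⟨ solve 7 (λ s p v u a b d → (s :* (p :* v)) :* (u :* (a :* (b :* d)))
                      := (s :* (u :* p) :* b) :* (v :* (a :* d)))
             refl s (s ^ toℕ j) (s ^ toℕ l) (s ^ toℕ i) a₀ b d ⟩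
      (s * (s ^ toℕ i * s ^ toℕ j) * b) * f l
        ≈⟨ *-congʳ (*-congʳ (*-congˡ (^-homo-* s (toℕ i) (toℕ j)))) ⟨
      e * f l ∎
      where
      k = punchIn j l
      q = dodge j l
      a₀ = A zero k
      b = A (suc i) j
      d = det (minor (minor A (suc i) j) zero l)
      iso′ : Isolated A (suc i) j → Isolated (minor A zero k) i q
      iso′ (inj₁ row) = inj₁ λ c → trans
        (reflexive (≡.cong (A (suc i)) (punchIn-punchIn-dodge j l c))) (row (punchIn l c))
      iso′ (inj₂ col) = inj₂ λ r → trans
        (reflexive (≡.cong (A (suc (punchIn i r))) (punchIn-dodge j l))) (col (suc r))

-- Index maps with a gap.

open import Defs
open import Data.Nat.Base as ℕ using (ℕ; _+_; _*_; _∸_; _≤_)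
open import Data.Product using (Σ-syntax; _×_)

open Laplace ℤ[x] using (Matrix; minor; det-isolated; det-cong; -1*-1≈1)
open CommutativeRing ℤ[x] using (setoid; commutativeSemiring; semiring; ring; reflexive)
open import Algebra.Properties.Ring ring using (-1*x≈-x)
open import Algebra.Properties.Semiring.Exp semiring using (^-homo-*; ^-congˡ; ^-congʳ)
open import Algebra.Solver.Ring.NaturalCoefficients.Default commutativeSemiring
  using (solve; _:=_; _:*_; con)
import Relation.Binary.Reasoning.Setoid setoid as ≈-R

-- The increasing enumeration of the naturals that skips the `d` indices from `m` on; `shift m 1` is
-- `punchIn` at `m`, read on naturals.
shift : ℕ → ℕ → ℕ → ℕ
shift zero    d i       = d + i
shift (suc m) d zero    = zero
shift (suc m) d (suc i) = suc (shift m d i)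

shift-< : ∀ {m i} d → i < m → shift m d i ≡ i
shift-< {suc m} {zero}  d _         = ≡.refl
shift-< {suc m} {suc i} d (s<s i<m) = ≡.cong suc (shift-< d i<m)

shift-≥ : ∀ {m i} d → m ≤ i → shift m d i ≡ d + i
shift-≥ d z≤n               = ≡.refl
shift-≥ d (s≤s {n = i} m≤i) = ≡.trans (≡.cong suc (shift-≥ d m≤i)) (≡.sym (ℕₚ.+-suc d i))

shift-≤ : ∀ m d i → shift m d i ≤ d + i
shift-≤ zero    d i       = ℕₚ.≤-refl
shift-≤ (suc m) d zero    = z≤n
shift-≤ (suc m) d (suc i) = ℕₚ.≤-trans (s≤s (shift-≤ m d i)) (ℕₚ.≤-reflexive (≡.sym (ℕₚ.+-suc d i)))

shift-0 : ∀ m i → shift m 0 i ≡ i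
shift-0 zero    i       = ≡.refl
shift-0 (suc m) zero    = ≡.refl
shift-0 (suc m) (suc i) = ≡.cong suc (shift-0 m i)

shift-shift : ∀ m d i → shift m d (shift m 1 i) ≡ shift m (suc d) i
shift-shift zero    d i       = ℕₚ.+-suc d i
shift-shift (suc m) d zero    = ≡.refl
shift-shift (suc m) d (suc i) = ≡.cong suc (shift-shift m d i)

-- `m + d` is the index lost when the gap widens from `d` to `suc d`.
shift-≢ : ∀ m d i → shift m (suc d) i ≢ m + d
shift-≢ zero    d i       eq = ℕₚ.m+1+n≢m d (≡.trans (ℕₚ.+-suc d i) eq)
shift-≢ (suc m) d (suc i) eq = shift-≢ m d i (ℕₚ.suc-injective eq)

toℕ-punchIn : ∀ {n} (i : Fin (suc n)) j → toℕ (punchIn i j) ≡ shift (toℕ i) 1 (toℕ j)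
toℕ-punchIn zero    j       = ≡.refl
toℕ-punchIn (suc i) zero    = ≡.refl
toℕ-punchIn (suc i) (suc j) = ≡.cong suc (toℕ-punchIn i j)

-- Zero and nonzero entries of the Hankel matrix.

suc[2^k∸1]≡2^k : ∀ k → suc (2 ℕ.^ k ∸ 1) ≡ 2 ℕ.^ k
suc[2^k∸1]≡2^k k = ℕₚ.m+[n∸m]≡n (ℕₚ.m^n>0 2 k)

a-mersenne : ∀ k {n} → suc n ≡ 2 ℕ.^ k → a n ≡ x (2 ℕ.^ k ∸ 1)
a-mersenne k {n} eq = ≡.trans
  (≡.cong (λ b → if b then x n else 𝟘) (dec-true (mersenne? n) (k , n≡)))
  (≡.cong x n≡)
  where
  n≡ : n ≡ 2 ℕ.^ k ∸ 1
  n≡ = ≡.cong ℕ.pred eq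

2^-cancel-< : ∀ {i j} → 2 ℕ.^ i < 2 ℕ.^ j → i < j
2^-cancel-< lt = ℕₚ.≰⇒> λ j≤i → ℕₚ.<⇒≱ lt (ℕₚ.^-monoʳ-≤ 2 j≤i)

-- `a n` is nonzero only if `suc n` is a power of two, and the only such power strictly between the
-- two bounds is the excluded one.
a-zero : ∀ k {n} → 2 ℕ.^ k < suc n → suc n < 2 ℕ.^ (2 + k) → suc n ≢ 2 ℕ.^ suc k → a n ≡ 𝟘
a-zero k {n} lo hi ne = ≡.cong (λ b → if b then x n else 𝟘) (dec-false (mersenne? n) not)
  where
  not : ¬ (∃[ j ] n ≡ 2 ℕ.^ j ∸ 1)
  not (j , n≡) = ne (≡.trans eq (≡.cong (2 ℕ.^_) (ℕₚ.≤-antisym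
      (ℕ.s≤s⁻¹ (2^-cancel-< {j} {2 + k} (≡.subst (_< 2 ℕ.^ (2 + k)) eq hi)))
      (2^-cancel-< {k} {j} (≡.subst (2 ℕ.^ k <_) eq lo)))))
    where
    eq : suc n ≡ 2 ℕ.^ j
    eq = ≡.trans (≡.cong suc n≡) (suc[2^k∸1]≡2^k j)

m+o≡n⇒m≤n : ∀ {m n} o → m + o ≡ n → m ≤ n
m+o≡n⇒m≤n o eq = ≡.subst (_ ≤_) eq (ℕₚ.m≤m+n _ o)

-- The Hankel matrix restricted to the rows and columns with index below m or
-- between m + d and 2s + m + d.
H : ∀ m s d → Matrix (suc (s * 2 + m))
H m s d i j = a (shift m d (toℕ i) + shift m d (toℕ j) + 1)

y : ℕ → Poly
y k = x (2 ℕ.^ suc k ∸ 1)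

entry-pivot : ∀ k m s d → m + suc (s + d) ≡ 2 ℕ.^ k →
  a ((d + (s * 2 + m)) + (d + m) + 1) ≡ y k
entry-pivot k m s d eq = a-mersenne (suc k) (≡.trans (lemma m s d) (≡.cong (2 *_) eq))
  where
  lemma : ∀ m s d → suc ((d + (s * 2 + m)) + (d + m) + 1) ≡ 2 * (m + suc (s + d))
  lemma = solve-∀

-- d + (2s + m) is the largest index occurring in H m s d
entry-zero : ∀ k m s d {v} → m + suc (s + d) ≡ 2 ℕ.^ k →
  v ≤ d + (s * 2 + m) → v ≢ m + d → a ((d + (s * 2 + m)) + v + 1) ≡ 𝟘
entry-zero k m s d {v} eq v≤ v≢ = a-zero k
  -- With N = `2 ^ k`, the number `u + v + 2` lies strictly between N and 4N, and it equals 2N only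
  -- for `v = m + d`.
  (≡.subst (_< _) eq (m+o≡n⇒m≤n (s + v) (lo m s d v)))
  (≡.subst (suc (u + v + 1) <_) (≡.cong (λ z → 2 * (2 * z)) eq)
    (ℕₚ.≤-<-trans (s≤s (ℕₚ.+-monoˡ-≤ 1 (ℕₚ.+-monoʳ-≤ u v≤))) (m+o≡n⇒m≤n _ (hi m s d))))
  λ eq′ → v≢ (ℕₚ.+-cancelˡ-≡ (s * 2 + m + d + 2) v (m + d)
    (≡.trans (mid₁ m s d v) (≡.trans eq′ (≡.trans (≡.cong (2 *_) (≡.sym eq)) (mid₂ m s d)))))
  where
  u = d + (s * 2 + m)
  lo : ∀ m s d v → suc (m + suc (s + d)) + (s + v) ≡ suc ((d + (s * 2 + m)) + v + 1)
  lo = solve-∀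
  hi : ∀ m s d → let u = d + (s * 2 + m) in
    suc (suc (u + u + 1)) + (2 * m + 2 * d + 1) ≡ 2 * (2 * (m + suc (s + d)))
  hi = solve-∀
  mid₁ : ∀ m s d v → s * 2 + m + d + 2 + v ≡ suc (d + (s * 2 + m) + v + 1)
  mid₁ = solve-∀
  mid₂ : ∀ m s d → 2 * (m + suc (s + d)) ≡ s * 2 + m + d + 2 + (m + d)
  mid₂ = solve-∀

toℕ-punchIn-fromℕ< : ∀ {m n} (m<1+n : m < suc n) j → toℕ (punchIn (fromℕ< m<1+n) j) ≡ shift m 1 (toℕ j)
toℕ-punchIn-fromℕ< m<1+n j = ≡.trans (toℕ-punchIn (fromℕ< m<1+n) j)
  (≡.cong (λ i → shift i 1 (toℕ j)) (Finₚ.toℕ-fromℕ< m<1+n))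

toℕ-punchIn-fromℕ : ∀ n (j : Fin n) → toℕ (punchIn (fromℕ n) j) ≡ toℕ j
toℕ-punchIn-fromℕ n j = ≡.trans (toℕ-punchIn (fromℕ n) j)
  (≡.trans (≡.cong (λ i → shift i 1 (toℕ j)) (Finₚ.toℕ-fromℕ n)) (shift-< 1 (Finₚ.toℕ<n j)))

-- Peeling off outer rows and columns: the reflection formula for `D`.

σ : Poly
σ = ⊝ 𝟙

σ^n*σ^n≈1 : ∀ n → σ ^ n ⊗ σ ^ n ≈ 𝟙
σ^n*σ^n≈1 zero    = ⊗-idˡ 𝟙
σ^n*σ^n≈1 (suc n) = begin
  (σ ⊗ σ ^ n) ⊗ (σ ⊗ σ ^ n) ≈⟨ solve 2 (λ s p → (s :* p) :* (s :* p) := (s :* s) :* (p :* p)) ≈-refl σ (σ ^ n) ⟩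
  (σ ⊗ σ) ⊗ (σ ^ n ⊗ σ ^ n) ≈⟨ ⊗-cong -1*-1≈1 (σ^n*σ^n≈1 n) ⟩
  𝟙 ⊗ 𝟙                     ≈⟨ ⊗-idˡ 𝟙 ⟩
  𝟙                         ∎
  where open ≈-R

a-cong : ∀ {i i′ j j′} → i ≡ i′ → j ≡ j′ → a (i + j + 1) ≡ a (i′ + j′ + 1)
a-cong = ≡.cong₂ λ i j → a (i + j + 1)

-- The last row, and then the last column, have a single nonzero entry,
-- facing position m; deleting both leaves the same matrix with a wider gap.
det-H-suc : ∀ k m s d → m + suc (suc s + d) ≡ 2 ℕ.^ k →
  det (H m (suc s) d) ≈ σ ⊗ (y k ⊗ (y k ⊗ det (H m s (suc d))))
det-H-suc k m s d eq = begin
  det A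
    ≈⟨ det-isolated A last M (inj₁ row) ⟩
  σ ^ (toℕ last + toℕ M) ⊗ (A last M ⊗ det B)
    ≈⟨ ⊗-cong (^-congʳ σ (≡.trans (≡.cong₂ _+_ (Finₚ.toℕ-fromℕ _) (Finₚ.toℕ-fromℕ< m<₁)) (≡.cong suc (ℕₚ.+-comm L′ m))))
              (⊗-cong (reflexive pivot₁) (det-isolated B M′ last′ (inj₂ col))) ⟩
  σ ^ suc (m + L′) ⊗ (y k ⊗ (σ ^ (toℕ M′ + toℕ last′) ⊗ (B M′ last′ ⊗ det (minor B M′ last′))))
    ≈⟨ ⊗-cong ≈-refl (⊗-cong ≈-refl (⊗-cong
         (^-congʳ σ (≡.cong₂ _+_ (Finₚ.toℕ-fromℕ< m<₂) (Finₚ.toℕ-fromℕ _)))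
         (⊗-cong (reflexive pivot₂) (det-cong λ r c →
           reflexive (a-cong (row-index r)
             (≡.trans (column-index (punchIn last′ c)) (≡.cong (shift m (suc d)) (toℕ-punchIn-fromℕ L′ c)))))))) ⟩
  (σ ⊗ p) ⊗ (y k ⊗ (p ⊗ (y k ⊗ det (H m s (suc d)))))
    -- The two sign exponents, `suc (m + L′)` and `m + L′`, differ by one, so a single `σ` survives.
    ≈⟨ solve 4 (λ s p z e → (s :* p) :* (z :* (p :* (z :* e))) := (p :* p) :* (s :* (z :* (z :* e))))
         ≈-refl σ p (y k) (det (H m s (suc d))) ⟩
  (p ⊗ p) ⊗ (σ ⊗ (y k ⊗ (y k ⊗ det (H m s (suc d)))))
    ≈⟨ ⊗-cong (σ^n*σ^n≈1 (m + L′)) ≈-refl ⟩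
  𝟙 ⊗ (σ ⊗ (y k ⊗ (y k ⊗ det (H m s (suc d)))))
    ≈⟨ ⊗-idˡ _ ⟩
  σ ⊗ (y k ⊗ (y k ⊗ det (H m s (suc d)))) ∎
  where
  open ≈-R
  L′ = suc (s * 2 + m)
  L = suc L′
  p = σ ^ (m + L′)

  m≤L′ : m ≤ L′
  m≤L′ = ℕₚ.≤-trans (ℕₚ.m≤n+m m (s * 2)) (ℕₚ.n≤1+n _)
  m≤L : m ≤ L
  m≤L = ℕₚ.m≤n⇒m≤1+n m≤L′
  m<₁ : m < suc L
  m<₁ = s≤s m≤L
  m<₂ : m < suc L′
  m<₂ = s≤s m≤L′

  A = H m (suc s) d
  last = fromℕ L
  M = fromℕ< m<₁
  B = minor A last M
  last′ = fromℕ L′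
  M′ = fromℕ< m<₂

  last-index : shift m d (toℕ last) ≡ d + L
  last-index = ≡.trans (≡.cong (shift m d) (Finₚ.toℕ-fromℕ L)) (shift-≥ d m≤L)

  column-index : ∀ c → shift m d (toℕ (punchIn M c)) ≡ shift m (suc d) (toℕ c)
  column-index c = ≡.trans (≡.cong (shift m d) (toℕ-punchIn-fromℕ< m<₁ c)) (shift-shift m d (toℕ c))

  row-index : ∀ r → shift m d (toℕ (punchIn last (punchIn M′ r))) ≡ shift m (suc d) (toℕ r)
  row-index r = ≡.trans (≡.cong (shift m d) (≡.trans (toℕ-punchIn-fromℕ L (punchIn M′ r)) (toℕ-punchIn-fromℕ< m<₂ r)))
    (shift-shift m d (toℕ r))

  M-index : shift m d m ≡ d + m
  M-index = shift-≥ d ℕₚ.≤-refl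

  last′-index : shift m d (toℕ (punchIn M last′)) ≡ d + L
  last′-index = ≡.trans (column-index last′) (≡.trans (≡.cong (shift m (suc d)) (Finₚ.toℕ-fromℕ L′))
    (≡.trans (shift-≥ (suc d) m≤L′) (≡.sym (ℕₚ.+-suc d L′))))

  pivot₁ : A last M ≡ y k
  pivot₁ = ≡.trans (a-cong last-index (≡.trans (≡.cong (shift m d) (Finₚ.toℕ-fromℕ< m<₁)) M-index))
    (entry-pivot k m (suc s) d eq)

  pivot₂ : B M′ last′ ≡ y k
  pivot₂ = ≡.trans (a-cong (≡.trans (≡.cong (shift m d) (≡.trans (toℕ-punchIn-fromℕ L M′) (Finₚ.toℕ-fromℕ< m<₂))) M-index) last′-index)
    (≡.trans (≡.cong (λ i → a (i + 1)) (ℕₚ.+-comm (d + m) (d + L))) (entry-pivot k m (suc s) d eq))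

  shifted-≤ : ∀ {i} → i < L → shift m (suc d) i ≤ d + L
  shifted-≤ {i} i<L = ℕₚ.≤-trans (shift-≤ m (suc d) i)
    (≡.subst (_≤ d + L) (ℕₚ.+-suc d i) (ℕₚ.+-monoʳ-≤ d i<L))

  row : ∀ c → A last (punchIn M c) ≈ 𝟘
  row c = reflexive (≡.trans (a-cong last-index (column-index c))
    (entry-zero k m (suc s) d eq (shifted-≤ (Finₚ.toℕ<n c)) (shift-≢ m d (toℕ c))))

  col : ∀ r → B (punchIn M′ r) last′ ≈ 𝟘
  col r = reflexive (≡.trans (a-cong (row-index r) last′-index)
    (≡.trans (≡.cong (λ i → a (i + 1)) (ℕₚ.+-comm (shift m (suc d) (toℕ r)) (d + L)))
      (entry-zero k m (suc s) d eq (shifted-≤ (ℕₚ.m<n⇒m<1+n (Finₚ.toℕ<n r))) (shift-≢ m d (toℕ r)))))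

-- The one index left beyond the gap is `d + m`, which faces itself: its pivot is on the diagonal,
-- so the sign is even, and what remains is the Hankel matrix of size `m`.
det-H-zero : ∀ k m d → m + suc d ≡ 2 ℕ.^ k → det (H m 0 d) ≈ y k ⊗ D m
det-H-zero k m d eq = begin
  det A                                                        ≈⟨ det-isolated A last last (inj₁ row) ⟩
  σ ^ (toℕ last + toℕ last) ⊗ (A last last ⊗ det (minor A last last))
    ≈⟨ ⊗-cong (^-congʳ σ (≡.cong₂ _+_ (Finₚ.toℕ-fromℕ m) (Finₚ.toℕ-fromℕ m)))
              (⊗-cong (reflexive (≡.trans (a-cong last-index last-index) (entry-pivot k m 0 d eq)))
                      (det-cong λ r c → reflexive (a-cong (index r) (index c)))) ⟩
  σ ^ (m + m) ⊗ (y k ⊗ D m)                                    ≈⟨ ⊗-cong (≈-trans (^-homo-* σ m m) (σ^n*σ^n≈1 m)) ≈-refl ⟩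
  𝟙 ⊗ (y k ⊗ D m)                                              ≈⟨ ⊗-idˡ _ ⟩
  y k ⊗ D m                                                    ∎
  where
  open ≈-R
  A = H m 0 d
  last = fromℕ m

  last-index : shift m d (toℕ last) ≡ d + m
  last-index = ≡.trans (≡.cong (shift m d) (Finₚ.toℕ-fromℕ m)) (shift-≥ d ℕₚ.≤-refl)

  index : ∀ c → shift m d (toℕ (punchIn last c)) ≡ toℕ c
  index c = ≡.trans (≡.cong (shift m d) (toℕ-punchIn-fromℕ m c)) (shift-< d (Finₚ.toℕ<n c))

  row : ∀ c → A last (punchIn last c) ≈ 𝟘
  row c = reflexive (≡.trans (a-cong last-index (index c)) (entry-zero k m 0 d eq
    (ℕₚ.≤-trans (ℕₚ.<⇒≤ (Finₚ.toℕ<n c)) (ℕₚ.m≤n+m m d))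
    (ℕₚ.<⇒≢ (ℕₚ.<-≤-trans (Finₚ.toℕ<n c) (ℕₚ.m≤m+n m d)))))

det-H : ∀ k m s d → m + suc (s + d) ≡ 2 ℕ.^ k →
  det (H m s d) ≈ σ ^ s ⊗ (y k ^ suc (s * 2) ⊗ D m)
det-H k m zero d eq = ≈-trans (det-H-zero k m d eq)
  (solve 2 (λ z e → z :* e := con 1 :* ((z :* con 1) :* e)) ≈-refl (y k) (D m))
det-H k m (suc s) d eq = begin
  det (H m (suc s) d)                           ≈⟨ det-H-suc k m s d eq ⟩
  σ ⊗ (z ⊗ (z ⊗ det (H m s (suc d))))
    ≈⟨ ⊗-cong ≈-refl (⊗-cong ≈-refl (⊗-cong ≈-refl
         -- Peeling moves one unit from `s` to `d`, so the sum in the hypothesis is unchanged.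
         (det-H k m s (suc d) (≡.trans (≡.cong (λ i → m + suc i) (ℕₚ.+-suc s d)) eq)))) ⟩
  σ ⊗ (z ⊗ (z ⊗ (σ ^ s ⊗ (z ^ suc (s * 2) ⊗ D m))))
    ≈⟨ solve 5 (λ σ z p q e → σ :* (z :* (z :* (p :* (q :* e)))) := (σ :* p) :* ((z :* (z :* q)) :* e))
         ≈-refl σ z (σ ^ s) (z ^ suc (s * 2)) (D m) ⟩
  σ ^ suc s ⊗ (z ^ suc (suc s * 2) ⊗ D m)       ∎
  where
  open ≈-R
  z = y k

-- With N = `2 ^ k`, `m` is N - 1 - r and the size on the left is N + r. That full matrix is
-- `H m r 0`, whose gap is empty.
D-reflect : ∀ k r m → m + suc r ≡ 2 ℕ.^ k →
  D (suc (r * 2 + m)) ≈ σ ^ r ⊗ (y k ^ suc (r * 2) ⊗ D m)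
D-reflect k r m eq = ≈-trans
  (det-cong {suc (r * 2 + m)} λ i j → reflexive (≡.sym (a-cong (shift-0 m (toℕ i)) (shift-0 m (toℕ j)))))
  (det-H k m r 0 (≡.trans (≡.cong (λ i → m + suc i) (ℕₚ.+-identityʳ r)) eq))

-- Induction along reflections, and nonvanishing of `D`.

reflection-view : ∀ n → ∃[ l ] ∃[ r ] ∃[ m ] (m + suc r ≡ 2 ℕ.^ l × r * 2 + m ≡ n)
reflection-view zero    = 0 , 0 , 0 , ≡.refl , ≡.refl
reflection-view (suc n) with reflection-view n
-- For `m = 0` the number `suc n` is `2 ^ suc l` minus one, so its successor opens the next dyadic
-- block, with `r = 0`.
... | l , r , zero  , eq , n≡ = suc l , 0 , suc (r * 2)
    , ≡.trans (lemma r) (≡.cong (2 *_) eq)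
    , ≡.cong suc (≡.trans (≡.sym (ℕₚ.+-identityʳ (r * 2))) n≡)
  where
  lemma : ∀ r → suc (r * 2) + 1 ≡ 2 * suc r
  lemma = solve-∀
... | l , r , suc m , eq , n≡ = l , suc r , m
    , ≡.trans (ℕₚ.+-suc m (suc r)) eq
    , ≡.cong suc (≡.trans (≡.sym (ℕₚ.+-suc (r * 2) m)) n≡)

-- Every positive number is N + r with N = `2 ^ l` and r < N; the step may use all values up to its
-- mirror image N - 1 - r, which is smaller.
reflection-rec : (Q : ℕ → Set) → Q 0 →
  (∀ l r m → m + suc r ≡ 2 ℕ.^ l → (∀ i → i ≤ m → Q i) → Q (suc (r * 2 + m))) → ∀ n → Q n
reflection-rec Q Q0 step = <-rec Q go
  where
  case : ∀ n → (∀ {i} → i < suc n → Q i) →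
    ∃[ l ] ∃[ r ] ∃[ m ] (m + suc r ≡ 2 ℕ.^ l × r * 2 + m ≡ n) → Q (suc n)
  case _ rec (l , r , m , eq , ≡.refl) = step l r m eq λ i i≤m →
    rec (s≤s (ℕₚ.≤-trans i≤m (ℕₚ.m≤n+m m (r * 2))))
  go : ∀ n → (∀ {i} → i < n → Q i) → Q n
  go zero    rec = Q0
  go (suc n) rec = case n rec (reflection-view n)

ev : Poly → ℤ
ev = eval (λ _ → 1ℤ)

ev-σ^ : ∀ n → ev (σ ^ n) ℤ.* ev (σ ^ n) ≡ 1ℤ
ev-σ^ n = eval-cong _ (σ^n*σ^n≈1 n)

ev-x^ : ∀ i n → ev (x i ^ n) ≡ 1ℤ
ev-x^ i zero    = ≡.refl
ev-x^ i (suc n) = ≡.trans (ℤₚ.*-identityˡ _) (ev-x^ i n)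

-- With every indeterminate set to 1, a reflection only changes the sign; squaring spares keeping
-- track of it.
ev-D : ∀ n → ev (D n) ℤ.* ev (D n) ≡ 1ℤ
ev-D = reflection-rec _ ≡.refl λ l r m eq rec → begin
  ev (D (suc (r * 2 + m))) ℤ.* ev (D (suc (r * 2 + m)))
    ≡⟨ ≡.cong (λ e → e ℤ.* e) (eval-cong _ (D-reflect l r m eq)) ⟩
  (ev (σ ^ r) ℤ.* (ev (y l ^ suc (r * 2)) ℤ.* ev (D m))) ℤ.* (ev (σ ^ r) ℤ.* (ev (y l ^ suc (r * 2)) ℤ.* ev (D m)))
    ≡⟨ ≡.cong (λ e → (ev (σ ^ r) ℤ.* (e ℤ.* ev (D m))) ℤ.* (ev (σ ^ r) ℤ.* (e ℤ.* ev (D m)))) (ev-x^ _ (suc (r * 2))) ⟩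
  (ev (σ ^ r) ℤ.* (1ℤ ℤ.* ev (D m))) ℤ.* (ev (σ ^ r) ℤ.* (1ℤ ℤ.* ev (D m)))
    ≡⟨ lemma (ev (σ ^ r)) (ev (D m)) ⟩
  (ev (σ ^ r) ℤ.* ev (σ ^ r)) ℤ.* (ev (D m) ℤ.* ev (D m))
    ≡⟨ ≡.cong₂ ℤ._*_ (ev-σ^ r) (rec m ℕₚ.≤-refl) ⟩
  1ℤ ∎
  where
  open ≡.≡-Reasoning
  lemma : ∀ s d → (s ℤ.* (1ℤ ℤ.* d)) ℤ.* (s ℤ.* (1ℤ ℤ.* d)) ≡ (s ℤ.* s) ℤ.* (d ℤ.* d)
  lemma = ℤ-Solver.solve-∀

D²≉0 : ∀ n → D n ^ 2 ≉ 𝟘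
D²≉0 n e = contradiction 1≡0 λ ()
  where
  open ≡.≡-Reasoning
  1≡0 : 1ℤ ≡ 0ℤ
  1≡0 = begin
    1ℤ                                  ≡⟨ ev-D n ⟨
    ev (D n) ℤ.* ev (D n)               ≡⟨ ≡.cong (ev (D n) ℤ.*_) (ℤₚ.*-identityʳ (ev (D n))) ⟨
    ev (D n) ℤ.* (ev (D n) ℤ.* 1ℤ)      ≡⟨ eval-cong (λ _ → 1ℤ) e ⟩
    0ℤ                                  ∎

-- Reflecting the cross-multiplied relations for `T`.

σσ : ∀ p → σ ⊗ (σ ⊗ p) ≈ p
σσ p = ≈-trans (≈-sym (⊗-assoc σ σ p)) (≈-trans (⊗-cong -1*-1≈1 ≈-refl) (⊗-idˡ p))

D-cong : ∀ {m n} → m ≡ n → D m ≈ D n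
D-cong eq = reflexive (≡.cong D eq)

-- With `q = 2 + m + r`, the four values of `D` from `2q` to `2q + 3` reflect, in reverse order,
-- onto those from `2m + 3` down to `2m`. These are the values that enter `T` at `2q` and `2q + 1`.
D-mirror : ∀ k i j r m → i + j ≡ 3 → m * 2 + 4 + r ≡ 2 ℕ.^ k →
  D (i + (2 + m + r) * 2) ≈ σ ^ (i + r) ⊗ (y k ^ suc ((i + r) * 2) ⊗ D (j + m * 2))
D-mirror k i j r m i+j≡3 eq = ≈-trans (D-cong (≡.sym index))
  (D-reflect k (i + r) (j + m * 2) (≡.trans (lemma₁ i j r m)
    (≡.trans (≡.cong (λ e → m * 2 + 1 + e + r) i+j≡3) (≡.trans (lemma₂ r m) eq))))
  where
  lemma₁ : ∀ i j r m → j + m * 2 + suc (i + r) ≡ m * 2 + 1 + (i + j) + r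
  lemma₁ = solve-∀
  lemma₂ : ∀ r m → m * 2 + 1 + 3 + r ≡ m * 2 + 4 + r
  lemma₂ = solve-∀
  lemma₃ : ∀ i j r m → suc ((i + r) * 2 + (j + m * 2)) ≡ (i + j) + (i + (1 + (m + r) * 2))
  lemma₃ = solve-∀
  lemma₄ : ∀ i r m → 3 + (i + (1 + (m + r) * 2)) ≡ i + (2 + m + r) * 2
  lemma₄ = solve-∀
  index : suc ((i + r) * 2 + (j + m * 2)) ≡ i + (2 + m + r) * 2
  index = ≡.trans (lemma₃ i j r m) (≡.trans (≡.cong (_+ (i + (1 + (m + r) * 2))) i+j≡3) (lemma₄ i r m))

-- P n c d stands for T n ≃ c / d with denominators cleared, and S n c d for
-- T (2n) ≃ c / d ≃ - T (2n + 1).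
P : ℕ → Poly → Poly → Set
P n c d = (D n ⊗ D (2 + n)) ⊗ d ≈ c ⊗ D (suc n) ^ 2

record S (n : ℕ) (c d : Poly) : Set where
  constructor _,_
  field
    even : P (n * 2) c d
    odd  : P (suc (n * 2)) (σ ⊗ c) d

-- T (2n + 1) ≃ - T (2n), with denominators cleared
record U (n : ℕ) : Set where
  constructor mk
  field
    opposite : (D (1 + n * 2) ⊗ D (3 + n * 2)) ⊗ D (1 + n * 2) ^ 2
             ≈ σ ⊗ ((D (n * 2) ⊗ D (2 + n * 2)) ⊗ D (2 + n * 2) ^ 2)

S-cong : ∀ n {c c′ d} → c ≈ c′ → S n c d → S n c′ d
S-cong n c≈c′ (p , q) = ≈-trans p (⊗-cong c≈c′ ≈-refl) , ≈-trans q (⊗-cong (⊗-cong ≈-refl c≈c′) ≈-refl)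

-- The primed triple appears reversed, as reflection requires. Because `u`, `v`, `w` are in
-- geometric progression, both sides of its relation are multiplied by the same factor.
P-scale : ∀ {A B C A′ B′ C′ c d} u v w → u ⊗ w ≈ v ⊗ v →
  A ≈ u ⊗ A′ → B ≈ v ⊗ B′ → C ≈ w ⊗ C′ →
  (C′ ⊗ A′) ⊗ d ≈ c ⊗ B′ ^ 2 → (A ⊗ C) ⊗ d ≈ c ⊗ B ^ 2
P-scale {A} {B} {C} {A′} {B′} {C′} {c} {d} u v w uw≈vv A≈ B≈ C≈ p = begin
  (A ⊗ C) ⊗ d                       ≈⟨ ⊗-cong (⊗-cong A≈ C≈) ≈-refl ⟩
  ((u ⊗ A′) ⊗ (w ⊗ C′)) ⊗ d         ≈⟨ solve 5 (λ u a w c d → ((u :* a) :* (w :* c)) :* d := (u :* w) :* ((c :* a) :* d)) ≈-refl u A′ w C′ d ⟩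
  (u ⊗ w) ⊗ ((C′ ⊗ A′) ⊗ d)         ≈⟨ ⊗-cong uw≈vv p ⟩
  (v ⊗ v) ⊗ (c ⊗ B′ ^ 2)            ≈⟨ solve 3 (λ v c b → (v :* v) :* (c :* (b :* (b :* con 1))) := c :* ((v :* b) :* ((v :* b) :* con 1))) ≈-refl v c B′ ⟩
  c ⊗ (v ⊗ B′) ^ 2                  ≈⟨ ⊗-cong ≈-refl (^-congˡ 2 B≈) ⟨
  c ⊗ B ^ 2                         ∎
  where open ≈-R

module Mirror (k r m : ℕ) (eq : m * 2 + 4 + r ≡ 2 ℕ.^ k) where
  open ≈-R

  factor : ℕ → Poly
  factor i = σ ^ (i + r) ⊗ y k ^ suc ((i + r) * 2)

  factor-suc : ∀ i → factor (suc i) ≈ σ ⊗ (y k ^ 2 ⊗ factor i)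
  factor-suc i = solve 4 (λ s p z q → (s :* p) :* (z :* (z :* q)) := s :* ((z :* (z :* con 1)) :* (p :* q)))
    ≈-refl σ (σ ^ (i + r)) (y k) (y k ^ suc ((i + r) * 2))

  factor-progression : ∀ i → factor i ⊗ factor (2 + i) ≈ factor (suc i) ⊗ factor (suc i)
  factor-progression i = begin
    t ⊗ factor (2 + i)                   ≈⟨ ⊗-cong ≈-refl (≈-trans (factor-suc (suc i)) (⊗-cong ≈-refl (⊗-cong ≈-refl (factor-suc i)))) ⟩
    t ⊗ (σ ⊗ (w ⊗ (σ ⊗ (w ⊗ t))))        ≈⟨ solve 3 (λ t s w → t :* (s :* (w :* (s :* (w :* t)))) := (s :* (w :* t)) :* (s :* (w :* t))) ≈-refl t σ w ⟩
    (σ ⊗ (w ⊗ t)) ⊗ (σ ⊗ (w ⊗ t))        ≈⟨ ⊗-cong (factor-suc i) (factor-suc i) ⟨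
    factor (suc i) ⊗ factor (suc i)      ∎
    where
    t = factor i
    w = y k ^ 2

  D≈ : ∀ i j → i + j ≡ 3 → D (i + (2 + m + r) * 2) ≈ factor i ⊗ D (j + m * 2)
  D≈ i j i+j≡3 = ≈-trans (D-mirror k i j r m i+j≡3 eq) (≈-sym (⊗-assoc _ _ _))

  -- Reversal exchanges the even and odd members of the pair; as they are opposite, the constant
  -- changes sign.
  S-mirror : ∀ {c d} → S m c d → S (2 + m + r) (σ ⊗ c) d
  S-mirror {c} (p , q) =
    P-scale (factor 0) (factor 1) (factor 2) (factor-progression 0)
      (D≈ 0 3 ≡.refl) (D≈ 1 2 ≡.refl) (D≈ 2 1 ≡.refl) q ,
    P-scale (factor 1) (factor 2) (factor 3) (factor-progression 1)
      (D≈ 1 2 ≡.refl) (D≈ 2 1 ≡.refl) (D≈ 3 0 ≡.refl) (≈-trans p (⊗-cong (≈-sym (σσ c)) ≈-refl))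

  U-mirror : U m → U (2 + m + r)
  U-mirror (mk u) = mk (begin
    (D (1 + N) ⊗ D (3 + N)) ⊗ D (1 + N) ^ 2
      ≈⟨ ⊗-cong (⊗-cong E₁ E₃) (^-congˡ 2 E₁) ⟩
    ((s ⊗ (w ⊗ t)) ⊗ d₂) ⊗ ((s ⊗ (w ⊗ (s ⊗ (w ⊗ (s ⊗ (w ⊗ t)))))) ⊗ d₀) ⊗ ((s ⊗ (w ⊗ t)) ⊗ d₂) ^ 2
      -- The prefactors on either side of the goal multiply to `s ⊗ g`, that is s^6 w^6 t^4: factors
      -- 1, 3, 1, 1 here and factors 0, 2, 2, 2 on the other side.
      ≈⟨ solve 5 (λ s w t d₀ d₂ →
             (((s :* (w :* t)) :* d₂) :* ((s :* (w :* (s :* (w :* (s :* (w :* t)))))) :* d₀))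
               :* (((s :* (w :* t)) :* d₂) :* (((s :* (w :* t)) :* d₂) :* con 1))
           := (s :* s :* s :* s :* s :* w :* w :* w :* w :* w :* w :* t :* t :* t :* t)
               :* (s :* ((d₀ :* d₂) :* (d₂ :* (d₂ :* con 1)))))
           ≈-refl s w t d₀ d₂ ⟩
    g ⊗ (s ⊗ ((d₀ ⊗ d₂) ⊗ d₂ ^ 2))
      ≈⟨ ⊗-cong ≈-refl u ⟨
    g ⊗ ((d₁ ⊗ d₃) ⊗ d₁ ^ 2)
      ≈⟨ σσ _ ⟨
    s ⊗ (s ⊗ (g ⊗ ((d₁ ⊗ d₃) ⊗ d₁ ^ 2)))
      ≈⟨ ⊗-cong ≈-refl (solve 5 (λ s w t d₁ d₃ →
             s :* ((s :* s :* s :* s :* s :* w :* w :* w :* w :* w :* w :* t :* t :* t :* t)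
               :* ((d₁ :* d₃) :* (d₁ :* (d₁ :* con 1))))
           := ((t :* d₃) :* ((s :* (w :* (s :* (w :* t)))) :* d₁))
               :* (((s :* (w :* (s :* (w :* t)))) :* d₁) :* (((s :* (w :* (s :* (w :* t)))) :* d₁) :* con 1)))
           ≈-refl s w t d₁ d₃) ⟩
    s ⊗ (((t ⊗ d₃) ⊗ ((s ⊗ (w ⊗ (s ⊗ (w ⊗ t)))) ⊗ d₁)) ⊗ ((s ⊗ (w ⊗ (s ⊗ (w ⊗ t)))) ⊗ d₁) ^ 2)
      ≈⟨ ⊗-cong ≈-refl (⊗-cong (⊗-cong (D≈ 0 3 ≡.refl) E₂) (^-congˡ 2 E₂)) ⟨
    s ⊗ ((D N ⊗ D (2 + N)) ⊗ D (2 + N) ^ 2) ∎)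
    where
    N = (2 + m + r) * 2
    s = σ
    w = y k ^ 2
    t = factor 0
    d₀ = D (m * 2)
    d₁ = D (1 + m * 2)
    d₂ = D (2 + m * 2)
    d₃ = D (3 + m * 2)
    g = s ⊗ s ⊗ s ⊗ s ⊗ s ⊗ w ⊗ w ⊗ w ⊗ w ⊗ w ⊗ w ⊗ t ⊗ t ⊗ t ⊗ t
    f₁ : factor 1 ≈ s ⊗ (w ⊗ t)
    f₁ = factor-suc 0
    f₂ : factor 2 ≈ s ⊗ (w ⊗ (s ⊗ (w ⊗ t)))
    f₂ = ≈-trans (factor-suc 1) (⊗-cong ≈-refl (⊗-cong ≈-refl f₁))
    f₃ : factor 3 ≈ s ⊗ (w ⊗ (s ⊗ (w ⊗ (s ⊗ (w ⊗ t)))))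
    f₃ = ≈-trans (factor-suc 2) (⊗-cong ≈-refl (⊗-cong ≈-refl f₂))
    E₁ = ≈-trans (D≈ 1 2 ≡.refl) (⊗-cong f₁ ≈-refl)
    E₂ = ≈-trans (D≈ 2 1 ≡.refl) (⊗-cong f₂ ≈-refl)
    E₃ = ≈-trans (D≈ 3 0 ≡.refl) (⊗-cong f₃ ≈-refl)

open Mirror using (S-mirror; U-mirror)

-- The pair of terms next to a power of two.

module Boundary (j n : ℕ) (eq : suc n ≡ 2 ℕ.^ j) where
  z δ₀ δ₁ : Poly
  z = y (suc j)
  δ₀ = D (n * 2)
  δ₁ = D (1 + n * 2)

  -- Here `2 + n * 2` is `2 ^ suc j`, so the four values of `D` involved reflect among themselves,
  -- and the last two reduce to `δ₁` and `δ₀`.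
  D₂≈ : D (2 + n * 2) ≈ 𝟙 ⊗ ((z ⊗ 𝟙) ⊗ δ₁)
  D₂≈ = D-reflect (suc j) 0 (1 + n * 2) (≡.trans (lemma n) (≡.cong (2 *_) eq))
    where
    lemma : ∀ n → 1 + n * 2 + 1 ≡ 2 * suc n
    lemma = solve-∀

  D₃≈ : D (3 + n * 2) ≈ (σ ⊗ 𝟙) ⊗ ((z ⊗ (z ⊗ (z ⊗ 𝟙))) ⊗ δ₀)
  D₃≈ = D-reflect (suc j) 1 (n * 2) (≡.trans (lemma n) (≡.cong (2 *_) eq))
    where
    lemma : ∀ n → n * 2 + 2 ≡ 2 * suc n
    lemma = solve-∀

  open ≈-R

  U-boundary : U n
  U-boundary = mk (begin
    (δ₁ ⊗ D (3 + n * 2)) ⊗ δ₁ ^ 2    ≈⟨ ⊗-cong (⊗-cong ≈-refl D₃≈) ≈-refl ⟩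
    (δ₁ ⊗ ((σ ⊗ 𝟙) ⊗ ((z ⊗ (z ⊗ (z ⊗ 𝟙))) ⊗ δ₀))) ⊗ δ₁ ^ 2
      ≈⟨ solve 4 (λ s z d₀ d₁ →
             (d₁ :* ((s :* con 1) :* ((z :* (z :* (z :* con 1))) :* d₀))) :* (d₁ :* (d₁ :* con 1))
           := s :* ((d₀ :* (con 1 :* ((z :* con 1) :* d₁)))
                :* ((con 1 :* ((z :* con 1) :* d₁)) :* ((con 1 :* ((z :* con 1) :* d₁)) :* con 1))))
           ≈-refl σ z δ₀ δ₁ ⟩
    σ ⊗ ((δ₀ ⊗ (𝟙 ⊗ ((z ⊗ 𝟙) ⊗ δ₁))) ⊗ (𝟙 ⊗ ((z ⊗ 𝟙) ⊗ δ₁)) ^ 2)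
      ≈⟨ ⊗-cong ≈-refl (⊗-cong (⊗-cong ≈-refl D₂≈) (^-congˡ 2 D₂≈)) ⟨
    σ ⊗ ((δ₀ ⊗ D (2 + n * 2)) ⊗ D (2 + n * 2) ^ 2) ∎)

  -- After the reduction the two terms are `z δ₀ / δ₁` and its negative, so only the ratio
  -- `δ₀ / δ₁`, given as `c / d`, has to be known.
  S-boundary : ∀ {c d} → δ₀ ⊗ d ≈ c ⊗ δ₁ → S n (c ⊗ z) d
  S-boundary {c} {d} δ₀d≈cδ₁ = first , second
    where
    first : P (n * 2) (c ⊗ z) d
    first = begin
      (δ₀ ⊗ D (2 + n * 2)) ⊗ d            ≈⟨ ⊗-cong (⊗-cong ≈-refl D₂≈) ≈-refl ⟩
      (δ₀ ⊗ (𝟙 ⊗ ((z ⊗ 𝟙) ⊗ δ₁))) ⊗ d     ≈⟨ solve 4 (λ z d₀ d₁ d → (d₀ :* (con 1 :* ((z :* con 1) :* d₁))) :* d := (z :* d₁) :* (d₀ :* d)) ≈-refl z δ₀ δ₁ d ⟩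
      (z ⊗ δ₁) ⊗ (δ₀ ⊗ d)                 ≈⟨ ⊗-cong ≈-refl δ₀d≈cδ₁ ⟩
      (z ⊗ δ₁) ⊗ (c ⊗ δ₁)                 ≈⟨ solve 3 (λ z d₁ c → (z :* d₁) :* (c :* d₁) := (c :* z) :* (d₁ :* (d₁ :* con 1))) ≈-refl z δ₁ c ⟩
      (c ⊗ z) ⊗ δ₁ ^ 2                    ∎
    second : P (suc (n * 2)) (σ ⊗ (c ⊗ z)) d
    second = begin
      (δ₁ ⊗ D (3 + n * 2)) ⊗ d            ≈⟨ ⊗-cong (⊗-cong ≈-refl D₃≈) ≈-refl ⟩
      (δ₁ ⊗ ((σ ⊗ 𝟙) ⊗ ((z ⊗ (z ⊗ (z ⊗ 𝟙))) ⊗ δ₀))) ⊗ d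
        ≈⟨ solve 5 (λ s z d₀ d₁ d → (d₁ :* ((s :* con 1) :* ((z :* (z :* (z :* con 1))) :* d₀))) :* d
             := (s :* z :* z :* z :* d₁) :* (d₀ :* d)) ≈-refl σ z δ₀ δ₁ d ⟩
      (σ ⊗ z ⊗ z ⊗ z ⊗ δ₁) ⊗ (δ₀ ⊗ d)     ≈⟨ ⊗-cong ≈-refl δ₀d≈cδ₁ ⟩
      (σ ⊗ z ⊗ z ⊗ z ⊗ δ₁) ⊗ (c ⊗ δ₁)
        ≈⟨ solve 4 (λ s z d₁ c → (s :* z :* z :* z :* d₁) :* (c :* d₁)
             := (s :* (c :* z)) :* ((con 1 :* ((z :* con 1) :* d₁)) :* ((con 1 :* ((z :* con 1) :* d₁)) :* con 1)))
             ≈-refl σ z δ₁ c ⟩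
      (σ ⊗ (c ⊗ z)) ⊗ (𝟙 ⊗ ((z ⊗ 𝟙) ⊗ δ₁)) ^ 2 ≈⟨ ⊗-cong ≈-refl (^-congˡ 2 D₂≈) ⟨
      (σ ⊗ (c ⊗ z)) ⊗ D (2 + n * 2) ^ 2   ∎

open Boundary using (S-boundary; U-boundary)

-- Base values, and their propagation to all indices.

D₁≈x₁ : D 1 ≈ x 1
D₁≈x₁ = ≈-trans (D-reflect 0 0 0 ≡.refl)
  (solve 1 (λ z → con 1 :* ((z :* con 1) :* con 1) := z) ≈-refl (x 1))

S-0 : S 0 (x 3) (x 1)
S-0 = S-cong 0 (⊗-idˡ (x 3)) (S-boundary 0 0 ≡.refl (⊗-cong ≈-refl (≈-sym D₁≈x₁)))

-- A further reflection, about `2 ^ j`, sends `δ₀` and `δ₁` to `D 1` and `D 0`. The second prefactor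
-- is `σ ⊗ y j ^ 2` times the first, so `δ₀ / δ₁` is `- x 1 / y j ^ 2`.
S-2^j∸1 : ∀ j r → 2 + r ≡ 2 ℕ.^ j → S (suc r) ((σ ⊗ x 1) ⊗ y (suc j)) (y j ^ 2)
S-2^j∸1 j r eq = S-boundary j (suc r) eq (begin
  D (suc r * 2) ⊗ z ^ 2
    ≈⟨ ⊗-cong (≡.subst (λ n → D n ≈ σ ^ r ⊗ (q ⊗ D 1)) (≡.cong suc (ℕₚ.+-comm (r * 2) 1)) (D-reflect j r 1 eq)) ≈-refl ⟩
  (σ ^ r ⊗ (q ⊗ D 1)) ⊗ z ^ 2
    ≈⟨ ⊗-cong (⊗-cong ≈-refl (⊗-cong ≈-refl D₁≈x₁)) ≈-refl ⟩
  (σ ^ r ⊗ (q ⊗ x 1)) ⊗ z ^ 2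
    ≈⟨ σσ _ ⟨
  σ ⊗ (σ ⊗ ((σ ^ r ⊗ (q ⊗ x 1)) ⊗ z ^ 2))
    ≈⟨ solve 5 (λ s p q x₁ z → s :* (s :* ((p :* (q :* x₁)) :* (z :* (z :* con 1))))
         := (s :* x₁) :* ((s :* p) :* ((z :* (z :* q)) :* con 1))) ≈-refl σ (σ ^ r) q (x 1) z ⟩
  (σ ⊗ x 1) ⊗ (σ ^ suc r ⊗ (z ^ suc (suc r * 2) ⊗ 𝟙))
    ≈⟨ ⊗-cong ≈-refl (≡.subst (λ n → D (suc n) ≈ σ ^ suc r ⊗ (z ^ suc (suc r * 2) ⊗ 𝟙)) (ℕₚ.+-identityʳ (suc r * 2)) (D-reflect j (suc r) 0 eq)) ⟨
  (σ ⊗ x 1) ⊗ D (1 + suc r * 2) ∎)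
  where
  open ≈-R
  z = y j
  q = z ^ suc (r * 2)

σ^[r*2]≈1 : ∀ r → σ ^ (r * 2) ≈ 𝟙
σ^[r*2]≈1 zero    = ≈-refl
σ^[r*2]≈1 (suc r) = ≈-trans (σσ _) (σ^[r*2]≈1 r)

-- Reflection about `2 ^ (2 + (j + l))` carries the odd multiple of `2 ^ j` numbered
-- `suc (r * 2 + m)` to the one numbered `m`. These numbers have opposite parity, which matches the
-- sign change in `S-mirror`.
S-odd-multiple : ∀ j {q₀ c d} → suc q₀ ≡ 2 ℕ.^ j → S q₀ c d →
  ∀ n q → suc q ≡ 2 ℕ.^ j * suc (n * 2) → S q (σ ^ n ⊗ c) d
S-odd-multiple j {q₀} {c} {d} eq₀ S₀ = reflection-rec _ base step
  where
  base : ∀ q → suc q ≡ 2 ℕ.^ j * 1 → S q (𝟙 ⊗ c) d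
  base q eq = ≡.subst (λ i → S i (𝟙 ⊗ c) d)
    (ℕₚ.suc-injective (≡.trans eq₀ (≡.trans (≡.sym (ℕₚ.*-identityʳ _)) (≡.sym eq))))
    (S-cong q₀ (≈-sym (⊗-idˡ c)) S₀)

  step : ∀ l r m → m + suc r ≡ 2 ℕ.^ l →
    (∀ i → i ≤ m → ∀ q → suc q ≡ 2 ℕ.^ j * suc (i * 2) → S q (σ ^ i ⊗ c) d) →
    ∀ q → suc q ≡ 2 ℕ.^ j * suc (suc (r * 2 + m) * 2) → S q (σ ^ suc (r * 2 + m) ⊗ c) d
  step l r m eq rec q eq-q = ≡.subst (λ i → S i (σ ^ suc (r * 2 + m) ⊗ c) d)
    (ℕₚ.suc-injective (≡.trans (index q₀ r m) (≡.trans (≡.cong (_* suc (suc (r * 2 + m) * 2)) eq₀) (≡.sym eq-q))))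
    (S-cong (2 + q′ + R) sign
      (S-mirror (2 + (j + l)) R q′
        (≡.trans (centre q₀ r m) (≡.cong (λ i → 2 * (2 * i))
          (≡.trans (≡.cong₂ _*_ eq₀ eq) (≡.sym (ℕₚ.^-distribˡ-+-* 2 j l)))))
        (rec m ℕₚ.≤-refl q′ (≡.cong (_* suc (m * 2)) eq₀))))
    where
    -- As `suc q₀` is `2 ^ j`, these are 2^j (2m + 1) - 1 and 2 (2^j (2r + 1) - 1), written without
    -- subtraction.
    q′ = m * 2 + q₀ * suc (m * 2)
    R = (q₀ + suc q₀ * (r * 2)) * 2
    index : ∀ q₀ r m → suc (2 + (m * 2 + q₀ * suc (m * 2)) + (q₀ + suc q₀ * (r * 2)) * 2)
      ≡ suc q₀ * suc (suc (r * 2 + m) * 2)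
    index = solve-∀
    centre : ∀ q₀ r m → (m * 2 + q₀ * suc (m * 2)) * 2 + 4 + (q₀ + suc q₀ * (r * 2)) * 2
      ≡ 2 * (2 * (suc q₀ * (m + suc r)))
    centre = solve-∀
    sign : σ ⊗ (σ ^ m ⊗ c) ≈ σ ^ suc (r * 2 + m) ⊗ c
    sign = begin
      σ ⊗ (σ ^ m ⊗ c)                    ≈⟨ ⊗-assoc σ (σ ^ m) c ⟨
      (σ ⊗ σ ^ m) ⊗ c                    ≈⟨ ⊗-cong (⊗-cong ≈-refl (≈-trans (⊗-cong (σ^[r*2]≈1 r) ≈-refl) (⊗-idˡ _))) ≈-refl ⟨
      (σ ⊗ (σ ^ (r * 2) ⊗ σ ^ m)) ⊗ c    ≈⟨ ⊗-cong (⊗-cong ≈-refl (^-homo-* σ (r * 2) m)) ≈-refl ⟨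
      σ ^ suc (r * 2 + m) ⊗ c            ∎
      where open ≈-R

U-all : ∀ n → U n
U-all = reflection-rec U (U-boundary 0 0 ≡.refl) step
  where
  step : ∀ l r m → m + suc r ≡ 2 ℕ.^ l → (∀ i → i ≤ m → U i) → U (suc (r * 2 + m))
  -- For `m = 0` the successor of the index is `2 ^ suc l`: the boundary case. Otherwise the pair
  -- reflects about `2 ^ suc l`.
  step l r zero eq rec = U-boundary (suc l) _ (≡.trans (lemma r) (≡.cong (2 *_) eq))
    where
    lemma : ∀ r → suc (suc (r * 2 + 0)) ≡ 2 * suc r
    lemma = solve-∀
  step l r (suc m) eq rec = ≡.subst U (index r m)
    (U-mirror (suc l) (r * 2) m (≡.trans (centre r m) (≡.cong (2 *_) eq)) (rec m (ℕₚ.n≤1+n m)))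
    where
    index : ∀ r m → 2 + m + r * 2 ≡ suc (r * 2 + suc m)
    index = solve-∀
    centre : ∀ r m → m * 2 + 4 + r * 2 ≡ 2 * (suc m + suc r)
    centre = solve-∀

-- Assembling the three identities.

T-≃ : ∀ {c d n n′} → n ≡ n′ → P n c d → (D n′ ⊗ D (n′ + 2)) ⊗ d ≈ c ⊗ D (n′ + 1) ^ 2
T-≃ {c} {d} {n} ≡.refl p = ≡.subst₂ (λ i j → (D n ⊗ D i) ⊗ d ≈ c ⊗ D j ^ 2) (ℕₚ.+-comm 2 n) (ℕₚ.+-comm 1 n) p

theorem5p7 : Σ[ D²≉0 ∈ (∀ n → D (n + 1) ^ 2 ≉ 𝟘) ]
    ( (∀ n → T D²≉0 (2 * n + 1) ≃ - T D²≉0 (2 * n))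
    × (∀ n → T D²≉0 (4 * n) ≃ ((⊝ 𝟙) ^ n ⊗ x 3) / x 1 ⟨ x≉0 1 ⟩)
    × (∀ k n → 2 ≤ k →
    T D²≉0 (2 ℕ.^ (k + 1) * n + 2 ℕ.^ k ∸ 1)
    ≃ ((⊝ 𝟙) ^ n ⊗ (x 1 ⊗ x (2 ℕ.^ (k + 1) ∸ 1)))
    / x (2 ℕ.^ k ∸ 1) ^ 2 ⟨ x²≉0 (2 ℕ.^ k ∸ 1) ⟩) )
theorem5p7 = (λ n → D²≉0 (n + 1)) , odd , multiple-of-4 , mersenne
  where
  2n+1 : ∀ n → 2 * n + 1 ≡ 1 + n * 2
  2n+1 = solve-∀
  2n+2 : ∀ n → 2 * n + 1 + 1 ≡ 2 + n * 2
  2n+2 = solve-∀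
  2n+2′ : ∀ n → 2 * n + 2 ≡ 2 + n * 2
  2n+2′ = solve-∀
  2n+3 : ∀ n → 2 * n + 1 + 2 ≡ 3 + n * 2
  2n+3 = solve-∀

  odd : ∀ n → (D (2 * n + 1) ⊗ D (2 * n + 1 + 2)) ⊗ D (2 * n + 1) ^ 2
    ≈ (⊝ (D (2 * n) ⊗ D (2 * n + 2))) ⊗ D (2 * n + 1 + 1) ^ 2
  odd n = begin
    (D (2 * n + 1) ⊗ D (2 * n + 1 + 2)) ⊗ D (2 * n + 1) ^ 2
      ≈⟨ ⊗-cong (⊗-cong (D-cong (2n+1 n)) (D-cong (2n+3 n))) (^-congˡ 2 (D-cong (2n+1 n))) ⟩
    (D (1 + n * 2) ⊗ D (3 + n * 2)) ⊗ D (1 + n * 2) ^ 2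
      ≈⟨ U.opposite (U-all n) ⟩
    σ ⊗ ((D (n * 2) ⊗ D (2 + n * 2)) ⊗ D (2 + n * 2) ^ 2)
      ≈⟨ ⊗-assoc σ (D (n * 2) ⊗ D (2 + n * 2)) (D (2 + n * 2) ^ 2) ⟨
    (σ ⊗ (D (n * 2) ⊗ D (2 + n * 2))) ⊗ D (2 + n * 2) ^ 2
      ≈⟨ ⊗-cong (-1*x≈-x (D (n * 2) ⊗ D (2 + n * 2))) ≈-refl ⟩
    (⊝ (D (n * 2) ⊗ D (2 + n * 2))) ⊗ D (2 + n * 2) ^ 2
      ≈⟨ ⊗-cong (⊝-cong (⊗-cong (D-cong (ℕₚ.*-comm 2 n)) (D-cong (2n+2′ n)))) (^-congˡ 2 (D-cong (2n+2 n))) ⟨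
    (⊝ (D (2 * n) ⊗ D (2 * n + 2))) ⊗ D (2 * n + 1 + 1) ^ 2 ∎
    where open ≈-R

  multiple-of-4 : ∀ n → (D (4 * n) ⊗ D (4 * n + 2)) ⊗ x 1 ≈ (σ ^ n ⊗ x 3) ⊗ D (4 * n + 1) ^ 2
  -- `4n` is the even member of pair `2n`, and `2n + 1` is an odd multiple of `2 ^ 0`.
  multiple-of-4 n = T-≃ (lemma n) (S.even (S-odd-multiple 0 ≡.refl S-0 n (n * 2) (≡.sym (ℕₚ.*-identityˡ _))))
    where
    lemma : ∀ n → n * 2 * 2 ≡ 4 * n
    lemma = solve-∀

  mersenne : ∀ k n → 2 ≤ k → let N = 2 ℕ.^ (k + 1) * n + 2 ℕ.^ k ∸ 1 in
    (D N ⊗ D (N + 2)) ⊗ x (2 ℕ.^ k ∸ 1) ^ 2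
      ≈ (σ ^ n ⊗ (x 1 ⊗ x (2 ℕ.^ (k + 1) ∸ 1))) ⊗ D (N + 1) ^ 2
  mersenne (suc zero) n (s≤s ())
  -- The index is `2q + 1` with `suc q` equal to `2 ^ j * (2n + 1)`: the odd member of pair `q`.
  -- Since `j` is positive, `2 ^ j ∸ 1` has the successor form `suc (h * 2)` expected by `S-2^j∸1`.
  mersenne k@(suc j@(suc i)) n _ = T-≃ index
    (≈-trans (S.odd (S-odd-multiple j half S₀ n q suc[q]≡)) (⊗-cong sign ≈-refl))
    where
    h = 2 ℕ.^ i ∸ 1
    half : suc (suc (h * 2)) ≡ 2 ℕ.^ j
    half = ≡.trans (≡.cong (2 +_) (ℕₚ.*-comm h 2)) (≡.trans (lemma h) (≡.cong (2 *_) (suc[2^k∸1]≡2^k i)))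
      where
      lemma : ∀ h → 2 + 2 * h ≡ 2 * suc h
      lemma = solve-∀
    S₀ : S (suc (h * 2)) ((σ ⊗ x 1) ⊗ y k) (y j ^ 2)
    S₀ = S-2^j∸1 j (h * 2) half
    q = n * 2 + suc (h * 2) * suc (n * 2)
    suc[q]≡ : suc q ≡ 2 ℕ.^ j * suc (n * 2)
    suc[q]≡ = ≡.cong (_* suc (n * 2)) half
    index : suc (q * 2) ≡ 2 ℕ.^ (k + 1) * n + 2 ℕ.^ k ∸ 1
    index = ≡.trans (≡.cong (_∸ 1) (≡.trans (lemma q) (≡.trans (≡.cong (2 *_) suc[q]≡) (lemma′ (2 ℕ.^ j) n))))
      (≡.cong (λ K → 2 ℕ.^ K * n + 2 ℕ.^ k ∸ 1) (ℕₚ.+-comm 1 k))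
      where
      lemma : ∀ q → suc (suc (q * 2)) ≡ 2 * suc q
      lemma = solve-∀
      lemma′ : ∀ h n → 2 * (h * suc (n * 2)) ≡ 2 * (2 * h) * n + 2 * h
      lemma′ = solve-∀
    -- The sign of the odd member cancels the one in the base value.
    sign : σ ⊗ (σ ^ n ⊗ ((σ ⊗ x 1) ⊗ y k)) ≈ σ ^ n ⊗ (x 1 ⊗ x (2 ℕ.^ (k + 1) ∸ 1))
    sign = begin
      σ ⊗ (σ ^ n ⊗ ((σ ⊗ x 1) ⊗ y k))
        ≈⟨ solve 4 (λ s p a b → s :* (p :* ((s :* a) :* b)) := s :* (s :* (p :* (a :* b)))) ≈-refl σ (σ ^ n) (x 1) (y k) ⟩
      σ ⊗ (σ ⊗ (σ ^ n ⊗ (x 1 ⊗ y k)))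
        ≈⟨ σσ (σ ^ n ⊗ (x 1 ⊗ y k)) ⟩
      σ ^ n ⊗ (x 1 ⊗ y k)
        ≈⟨ ⊗-cong ≈-refl (⊗-cong ≈-refl (reflexive (≡.cong (λ K → x (2 ℕ.^ K ∸ 1)) (ℕₚ.+-comm 1 k)))) ⟩
      σ ^ n ⊗ (x 1 ⊗ x (2 ℕ.^ (k + 1) ∸ 1)) ∎
      where open ≈-R
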